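{- Let $k,n$ be integers with $k\geq 1$, $n\ge 0$, let $\lambda$ be a partition, and let $1\le i\le k-1$. There exists an involution $g=g_i:\mathrm{SSOT}_{k,n}(\lambda)\to\mathrm{SSOT}_{k,n}(\lambda)$ such that for every $S\in\mathrm{SSOT}_{k,n}(\lambda)$, $$(\mathrm{wt}_i\,g(S),\ \mathrm{wt}_{i+1}\,g(S))=(\mathrm{wt}_{i+1}S,\ \mathrm{wt}_iS)$$ and $\mathrm{wt}_j\,g(S)=\mathrm{wt}_jS$ for all $j\ne i,i+1$.
   Context: Partitions are identified with Young diagrams in English notation. A skew shape is a horizontal strip if it contains at most one box in each column. A $k$-semistandard oscillating tableau ($k$-SSOT) of final shape $\lambda$ is a finite sequence of partitions $S=(S^{1},S'^{2},S^{2},S'^{3},\dots,S'^{k},S^{k})$ such that, with $S'^{1}=\emptyset$: $S^{i}\supseteq S'^{i+1}$ and $S^i\setminus S'^{i+1}$ is a (possibly empty) horizontal strip for $1\le i\le k-1$; $S'^{i}\subseteq S^{i}$ and $S^i\setminus S'^i$ is a (possibly empty) horizontal strip for $1\le i\le k$; and $S^k=\lambda$. Step $i$ consists of deleting the boxes of $S^{i-1}\setminus S'^{i}$ (for $i\ge2$) and then adding the boxes of $S^i\setminus S'^i$. $S$ is identified with the multiset-valued tableau in which the letter $i$ is recorded at a box position once for each time that box is added or deleted in step $i$. $\mathrm{wt}_iS$ is the total number of letters $i$ in this multiset-valued tableau, i.e. the total number of boxes deleted and added in step $i$. The length of $S$ is the total number of letters, $\sum_i\mathrm{wt}_iS$.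 $\mathrm{SSOT}_{k,n}(\lambda)$ is the set of $k$-SSOTs of final shape $\lambda$ and length $n$. -}

module Defs where

open import Data.List.Base using (List; []; _∷_; _++_; concatMap; filter; length; map; upTo)
open import Data.List.Relation.Unary.All using (All; [])
open import Data.List.Relation.Unary.Linked using (Linked; [])
open import Data.Nat.Base using (ℕ; zero; suc; _≥_; _>_; _<_)
open import Data.Nat.Properties using (_≟_; _<?_)
open import Data.Product.Base using (Σ; _×_; _,_; proj₁; proj₂)
open import Relation.Binary.PropositionalEquality.Core using (_≡_)
open import Relation.Nullary.Decidable.Core using (Dec; ¬?)
open import Relation.Nullary.Negation.Core using (¬_)

-- Proof fields here and in Tableau are irrelevant, so that _≡_ compares only
-- the underlying combinatorial data.
record Partition : Set where
  constructor mkPartition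
  field
    parts       : List ℕ
    .decreasing : Linked _≥_ parts
    .positive   : All (_> 0) parts

open Partition public using (parts)

∅ : Partition
∅ = mkPartition [] [] []

nth : List ℕ → ℕ → ℕ
nth []       _       = 0
nth (x ∷ _)  zero    = x
nth (_ ∷ xs) (suc r) = nth xs r

-- Length of row r; rows are counted from 0 at the top (English notation).
row : Partition → ℕ → ℕ
row μ = nth (parts μ)

-- (row , column), both counted from 0.
Box : Set
Box = ℕ × ℕ

infix 4 _∈_ _∈?_ _∈_∖_ _⊆_

_∈_ : Box → Partition → Set
(r , c) ∈ μ = c < row μ r

_∈?_ : (b : Box) (μ : Partition) → Dec (b ∈ μ)
(r , c) ∈? μ = c <? row μ r

_∈_∖_ : Box → Partition → Partition → Set
b ∈ ρ ∖ μ = b ∈ ρ × ¬ (b ∈ μ)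

_⊆_ : Partition → Partition → Set
μ ⊆ ρ = ∀ b → b ∈ μ → b ∈ ρ

-- μ ⊆ ρ, and ρ ∖ μ has at most one box in each column.
HorizontalStrip : (ρ μ : Partition) → Set
HorizontalStrip ρ μ =
  μ ⊆ ρ × (∀ r r′ c → (r , c) ∈ ρ ∖ μ → (r′ , c) ∈ ρ ∖ μ → r ≡ r′)

boxes : Partition → List Box
boxes μ = concatMap (λ r → map (r ,_) (upTo (row μ r))) (upTo (length (parts μ)))

skewBoxes : (ρ μ : Partition) → List Box
skewBoxes ρ μ = filter (λ b → ¬? (b ∈? μ)) (boxes ρ)

-- Tableau k ρ is the type of k-semistandard oscillating tableaux of final
-- shape ρ, of any length.  In  step S ν ρ  the tableau S ends in Sᵏ = μ, and
-- ν = S′ᵏ⁺¹, ρ = Sᵏ⁺¹.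
data Tableau : ℕ → Partition → Set where
  first : (ρ : Partition) → .(HorizontalStrip ρ ∅) → Tableau 1 ρ
  step  : ∀ {k μ} → Tableau k μ → (ν ρ : Partition) →
          .(HorizontalStrip μ ν) → .(HorizontalStrip ρ ν) →
          Tableau (suc k) ρ

-- The multiset-valued tableau, as a list of (box , letter): the letter i occurs
-- at a box once for each time that box is deleted or added in step i.
letters : ∀ {k ρ} → Tableau k ρ → List (Box × ℕ)
letters (first ρ _) = map (_, 1) (skewBoxes ρ ∅)
letters (step {k} {μ} S ν ρ _ _) =
  letters S ++ map (_, suc k) (skewBoxes μ ν ++ skewBoxes ρ ν)

size : ∀ {k ρ} → Tableau k ρ → ℕ
size S = length (letters S)

SSOT : (k n : ℕ) → Partition → Set
SSOT k n ρ = Σ (Tableau k ρ) (λ S → size S ≡ n)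

wt : ∀ {k n ρ} → ℕ → SSOT k n ρ → ℕ
wt i (S , _) = length (filter (λ e → proj₂ e ≟ i) (letters S))

{-# OPTIONS --safe #-}

-- Steps i and i + 1 form a chain α ⊇ ν₁ ⊆ μ ⊇ ν₂ ⊆ β with α and β fixed.
-- Row r + 1 of μ ranges over the interval from ν₁(r+1) ⊔ ν₂(r+1) to
-- ν₁(r) ⊓ ν₂(r), which is also the range of row r of a partition κ such that
-- ν₁ ∖ κ and ν₂ ∖ κ are horizontal strips. Reflecting in these intervals
-- trades μ for such a κ and the excess m of row 0, with
-- |κ| + |μ| = m + |ν₁| + |ν₂|. The Bender–Knuth toggles replace ν₁ between α
-- and κ, and ν₂ between β and κ, with |ν₁| + |ν₁′| = |α| + |κ| and
-- |ν₂| + |ν₂′| = |β| + |κ|; then κ and m are traded back for μ′. Every stage is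
-- reversible, and the three identities show that the two weights are exchanged.
module Submission where

open import Data.List.Base using (List; []; _∷_; _++_; _∷ʳ_; concatMap; filter; length; map; upTo)
open import Data.List.Properties
  using (≡-dec; concatMap-++; filter-++; filter-accept; filter-all; filter-none; filter-reject;
         length-++; length-map; map-++; upTo-∷ʳ; ++-identityʳ)
open import Data.List.Relation.Unary.All using (All; []; _∷_; all?; universal)
open import Data.List.Relation.Unary.All.Properties using (map⁺)
open import Data.List.Relation.Unary.Linked using (Linked; []; [-]; _∷_; linked?; tail)
open import Data.Nat.Base using (ℕ; zero; suc; _+_; _∸_; _⊔_; _⊓_; _≤_; _≥_; _>_; _<_; z≤n; s≤s)
open import Data.Nat.Properties
open import Data.Nat.Solver using (module +-*-Solver)
open import Data.Product.Base using (Σ; _×_; _,_; proj₁; proj₂)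
open import Data.Sum.Base using (inj₁; inj₂)
open import Function.Base using (_∘_)
open import Relation.Binary.Definitions using (tri<; tri≈; tri>)
open import Relation.Binary.PropositionalEquality
  using (_≡_; _≢_; refl; sym; trans; cong; cong₂; subst; subst₂; ≢-sym; module ≡-Reasoning)
open import Relation.Nullary.Decidable using (Dec; yes; no; recompute; ¬?)
open import Relation.Nullary.Negation using (¬_; contradiction)
open import Algebra.Definitions using (Involutive)
open import Algebra.Properties.CommutativeSemigroup +-commutativeSemigroup using (interchange)
open import Defs

private
  module _ where
    open +-*-Solver

    +-swap : ∀ a b c d → (a + b) + (c + d) ≡ (a + d) + (b + c)
    +-swap = solve 4 (λ a b c d → (a :+ b) :+ (c :+ d) := (a :+ d) :+ (b :+ c)) refl

    +-inner : ∀ a b c d → (a + (b + c)) + d ≡ (a + c) + (b + d)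
    +-inner = solve 4 (λ a b c d → (a :+ (b :+ c)) :+ d := (a :+ c) :+ (b :+ d)) refl

≤-zero : ∀ {m n} → m ≤ n → n ≡ 0 → m ≡ 0
≤-zero m≤n n≡0 = n≤0⇒n≡0 (≤-trans m≤n (≤-reflexive n≡0))

-- Partitions and their row lengths

Decreasing : (ℕ → ℕ) → Set
Decreasing f = ∀ r → f (suc r) ≤ f r

decreasing-≤ : ∀ {f} → Decreasing f → ∀ {r s} → r ≤ s → f s ≤ f r
decreasing-≤ dec {zero}  {zero}  _         = ≤-refl
decreasing-≤ dec {zero}  {suc s} _         = ≤-trans (dec s) (decreasing-≤ dec {zero} {s} z≤n)
decreasing-≤ dec {suc r} {suc s} (s≤s r≤s) = decreasing-≤ (dec ∘ suc) r≤s

nth-decreasing : ∀ {xs} → Linked _≥_ xs → Decreasing (nth xs)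
nth-decreasing []        r       = z≤n
nth-decreasing [-]       r       = z≤n
nth-decreasing (x≥y ∷ l) zero    = x≥y
nth-decreasing (x≥y ∷ l) (suc r) = nth-decreasing l r

row-decreasing : ∀ μ → Decreasing (row μ)
row-decreasing (mkPartition xs dec pos) =
  nth-decreasing (recompute (linked? (λ x y → y ≤? x) xs) dec)

nth-beyond : ∀ xs {r} → length xs ≤ r → nth xs r ≡ 0
nth-beyond []       _         = refl
nth-beyond (x ∷ xs) (s≤s l≤r) = nth-beyond xs l≤r

nth-injective : ∀ {xs ys} → All (_> 0) xs → All (_> 0) ys →
                (∀ r → nth xs r ≡ nth ys r) → xs ≡ ys
nth-injective []        []        eq = refl
nth-injective []        (py ∷ _)  eq = contradiction (eq 0) (<⇒≢ py)
nth-injective (px ∷ _)  []        eq = contradiction (sym (eq 0)) (<⇒≢ px)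
nth-injective (_ ∷ pxs) (_ ∷ pys) eq = cong₂ _∷_ (eq 0) (nth-injective pxs pys (eq ∘ suc))

parts-injective : ∀ {μ ρ} → parts μ ≡ parts ρ → μ ≡ ρ
parts-injective refl = refl

row-injective : ∀ {μ ρ} → (∀ r → row μ r ≡ row ρ r) → μ ≡ ρ
row-injective {mkPartition xs _ px} {mkPartition ys _ py} eq = parts-injective
  (nth-injective (recompute (all? (0 <?_) xs) px) (recompute (all? (0 <?_) ys) py) eq)

-- The strip conditions in a tableau are irrelevant, so equations derived from them are too;
-- decidable equality of the lists of parts makes them usable again.
recompute-≡ : ∀ {μ ρ : Partition} → .(μ ≡ ρ) → μ ≡ ρ
recompute-≡ {μ} {ρ} eq =
  parts-injective (recompute (≡-dec _≟_ (parts μ) (parts ρ)) (cong parts eq))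

-- Taking the running minimum with c and stopping at 0 makes the result a
-- partition for every f, so that constructions on partitions need no proofs.
clip : ℕ → (ℕ → ℕ) → ℕ → List ℕ
clip c f zero    = []
clip c f (suc N) with c ⊓ f 0
... | zero  = []
... | suc x = suc x ∷ clip (suc x) (f ∘ suc) N

clip-linked : ∀ c f N → Linked _≥_ (c ∷ clip c f N)
clip-linked c f zero    = [-]
clip-linked c f (suc N) with c ⊓ f 0 in eq
... | zero  = [-]
... | suc x = subst (_≤ c) eq (m⊓n≤m c (f 0)) ∷ clip-linked (suc x) (f ∘ suc) N

clip-positive : ∀ c f N → All (_> 0) (clip c f N)
clip-positive c f zero    = []
clip-positive c f (suc N) with c ⊓ f 0
... | zero  = []
... | suc x = s≤s z≤n ∷ clip-positive (suc x) (f ∘ suc) N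

decreasing-zero : ∀ {f} → Decreasing f → f 0 ≡ 0 → ∀ r → f r ≡ 0
decreasing-zero {f} dec f0≡0 r = ≤-zero (decreasing-≤ {f} dec z≤n) f0≡0

-- The cap never bites when `f 0 ≤ c` and `f` decreases, and once `f` reaches 0 it stays there, so
-- stopping early loses nothing.
nth-clip : ∀ c f N → Decreasing f → f 0 ≤ c → f N ≡ 0 → ∀ r → nth (clip c f N) r ≡ f r
nth-clip c f zero    dec f0≤c fN≡0 r = sym (decreasing-zero dec fN≡0 r)
nth-clip c f (suc N) dec f0≤c fN≡0 r with c ⊓ f 0 in eq
... | zero  = sym (decreasing-zero dec (trans (sym (m≥n⇒m⊓n≡n f0≤c)) eq) r)
nth-clip c f (suc N) dec f0≤c fN≡0 zero    | suc x = trans (sym eq) (m≥n⇒m⊓n≡n f0≤c)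
nth-clip c f (suc N) dec f0≤c fN≡0 (suc r) | suc x =
  nth-clip (suc x) (f ∘ suc) N (dec ∘ suc)
    (subst (f 1 ≤_) (trans (sym (m≥n⇒m⊓n≡n f0≤c)) eq) (dec 0)) fN≡0 r

fromRows : (ℕ → ℕ) → ℕ → Partition
fromRows f N = mkPartition (clip (f 0) f N) (tail (clip-linked (f 0) f N)) (clip-positive (f 0) f N)

row-fromRows : ∀ f N → Decreasing f → f N ≡ 0 → ∀ r → row (fromRows f N) r ≡ f r
row-fromRows f N dec = nth-clip (f 0) f N dec ≤-refl

-- Horizontal strips as interlacing rows

infix 4 _≽_

-- The form of `HorizontalStrip` by row lengths, ρ₀ ≥ μ₀ ≥ ρ₁ ≥ μ₁ ≥ ...: it confines rows to
-- intervals, on which reflections can act.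
record _≽_ (ρ μ : Partition) : Set where
  constructor mk≽
  field
    contained  : ∀ r → row μ r ≤ row ρ r
    interlaced : ∀ r → row ρ (suc r) ≤ row μ r

open _≽_

strip⇒≽ : ∀ {ρ μ} → HorizontalStrip ρ μ → ρ ≽ μ
strip⇒≽ {ρ} {μ} (μ⊆ρ , column) = mk≽ cont inter
  where
  cont : ∀ r → row μ r ≤ row ρ r
  cont r with row μ r ≤? row ρ r
  ... | yes p = p
  ... | no ¬p = contradiction (μ⊆ρ (r , row ρ r) (≰⇒> ¬p)) (<-irrefl refl)

  inter : ∀ r → row ρ (suc r) ≤ row μ r
  inter r with row ρ (suc r) ≤? row μ r
  ... | yes p = p
  -- Otherwise column `row μ r` has boxes of ρ ∖ μ in both rows r and r + 1.
  ... | no ¬p = contradiction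
    (column r (suc r) (row μ r)
      (<-≤-trans (≰⇒> ¬p) (row-decreasing ρ r) , <-irrefl refl)
      (≰⇒> ¬p , ≤⇒≯ (row-decreasing μ r)))
    (<⇒≢ (n<1+n r))

≽⇒strip : ∀ {ρ μ} → ρ ≽ μ → HorizontalStrip ρ μ
≽⇒strip {ρ} {μ} ρ≽μ = (λ (r , c) c< → <-≤-trans c< (contained ρ≽μ r)) , column
  where
  -- Interlacing puts a column that `ρ` reaches in a lower row inside `μ` in every row above; hence
  -- only the lowest box of `ρ` in a column can lie outside `μ`.
  above : ∀ {r r′ c} → r < r′ → c < row ρ r′ → c < row μ r
  above {r} r<r′ c< =
    <-≤-trans c< (≤-trans (decreasing-≤ (row-decreasing ρ) r<r′) (interlaced ρ≽μ r))

  column : ∀ r r′ c → (r , c) ∈ ρ ∖ μ → (r′ , c) ∈ ρ ∖ μ → r ≡ r′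
  column r r′ c (c∈ρ , c∉μ) (c∈ρ′ , c∉μ′) with <-cmp r r′
  ... | tri< r<r′ _ _ = contradiction (above r<r′ c∈ρ′) c∉μ
  ... | tri≈ _ r≡r′ _ = r≡r′
  ... | tri> _ _ r′<r = contradiction (above r′<r c∈ρ) c∉μ′

-- Reflection in intervals

reflect : ℕ → ℕ → ℕ → ℕ
reflect lo hi x = lo + hi ∸ x

module _ {lo hi x : ℕ} (lo≤x : lo ≤ x) (x≤hi : x ≤ hi) where

  x≤lo+hi : x ≤ lo + hi
  x≤lo+hi = ≤-trans x≤hi (m≤n+m hi lo)

  reflect-≥ : lo ≤ reflect lo hi x
  reflect-≥ = m+n≤o⇒m≤o∸n lo (+-monoʳ-≤ lo x≤hi)

  reflect-≤ : reflect lo hi x ≤ hi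
  reflect-≤ = m≤n+o⇒m∸n≤o (lo + hi) x (+-monoˡ-≤ hi lo≤x)

  reflect-involutive : reflect lo hi (reflect lo hi x) ≡ x
  reflect-involutive = m∸[m∸n]≡n x≤lo+hi

  reflect-+ : reflect lo hi x + x ≡ lo + hi
  reflect-+ = m∸n+n≡m x≤lo+hi

Within : (lo hi f : ℕ → ℕ) → Set
Within lo hi f = ∀ r → lo r ≤ f r × f r ≤ hi r

within-resp : ∀ {lo hi f g} → (∀ r → f r ≡ g r) → Within lo hi f → Within lo hi g
within-resp f≗g w r rewrite sym (f≗g r) = w r

toggle : (lo hi : ℕ → ℕ) → ℕ → (ℕ → ℕ) → Partition
toggle lo hi N f = fromRows (λ r → reflect (lo r) (hi r) (f r)) N

module Toggle (lo hi : ℕ → ℕ) (N : ℕ) (chain : ∀ r → hi (suc r) ≤ lo r) (hiN≡0 : hi N ≡ 0) where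

  module _ {f : ℕ → ℕ} (w : Within lo hi f) where

    reflect-within : Within lo hi (λ r → reflect (lo r) (hi r) (f r))
    reflect-within r = let l , h = w r in reflect-≥ l h , reflect-≤ l h

    -- `chain` puts the intervals in descending order, so any choice of one point in each is
    -- decreasing, and `hi N ≡ 0` empties row `N`. Hence `fromRows` alters nothing.
    row-toggle : ∀ r → row (toggle lo hi N f) r ≡ reflect (lo r) (hi r) (f r)
    row-toggle = row-fromRows _ N
      (λ r → ≤-trans (proj₂ (reflect-within (suc r))) (≤-trans (chain r) (proj₁ (reflect-within r))))
      (≤-zero (proj₂ (reflect-within N)) hiN≡0)

    toggle-within : Within lo hi (row (toggle lo hi N f))
    toggle-within = within-resp (sym ∘ row-toggle) reflect-within

    row-toggle-+ : ∀ r → row (toggle lo hi N f) r + f r ≡ lo r + hi r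
    row-toggle-+ r rewrite row-toggle r = let l , h = w r in reflect-+ l h

    reflect-row-toggle : ∀ r → reflect (lo r) (hi r) (row (toggle lo hi N f) r) ≡ f r
    reflect-row-toggle r rewrite row-toggle r = let l , h = w r in reflect-involutive l h

-- With `N` past the last row of a partition this is its size; sizes are compared at one common `N`.
∑< : ℕ → (ℕ → ℕ) → ℕ
∑< zero    f = 0
∑< (suc N) f = ∑< N f + f N

⊔+⊓ : ∀ m n → (m ⊔ n) + (m ⊓ n) ≡ m + n
⊔+⊓ m n with ≤-total m n
... | inj₁ m≤n rewrite m≤n⇒m⊔n≡n m≤n | m≤n⇒m⊓n≡m m≤n = +-comm n m
... | inj₂ n≤m rewrite m≥n⇒m⊔n≡m n≤m | m≥n⇒m⊓n≡n n≤m = refl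

-- The Bender–Knuth toggle

module BenderKnuth (α κ : Partition) where

  -- The interval left to row `r` of `ν` by α ≽ ν ≽ κ. Row 0 is bounded above by `α` alone, since
  -- `κ` has no row above it.
  lo hi : ℕ → ℕ
  lo r = row κ r ⊔ row α (suc r)
  hi zero    = row α 0
  hi (suc r) = row α (suc r) ⊓ row κ r

  hi≤α : ∀ r → hi r ≤ row α r
  hi≤α zero    = ≤-refl
  hi≤α (suc r) = m⊓n≤m (row α (suc r)) (row κ r)

  hi-chain : ∀ r → hi (suc r) ≤ lo r
  hi-chain r = ≤-trans (m⊓n≤n (row α (suc r)) _) (m≤m⊔n (row κ r) _)

  hi-zero : ∀ {N} → row α N ≡ 0 → hi N ≡ 0
  hi-zero {N} αN≡0 = ≤-zero (hi≤α N) αN≡0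

  bk : Partition → Partition
  bk ν = toggle lo hi (length (parts α)) (row ν)

  open Toggle lo hi (length (parts α)) hi-chain (hi-zero (nth-beyond (parts α) ≤-refl))

  ≽⇒within : ∀ {ν} → α ≽ ν → ν ≽ κ → Within lo hi (row ν)
  ≽⇒within {ν} α≽ν ν≽κ r = ⊔-lub (contained ν≽κ r) (interlaced α≽ν r) , upper r
    where
    upper : ∀ r → row ν r ≤ hi r
    upper zero    = contained α≽ν 0
    upper (suc r) = ⊓-glb (contained α≽ν (suc r)) (interlaced ν≽κ r)

  within⇒α≽ : ∀ {ν} → Within lo hi (row ν) → α ≽ ν
  within⇒α≽ w = mk≽
    (λ r → ≤-trans (proj₂ (w r)) (hi≤α r))
    (λ r → ≤-trans (m≤n⊔m (row κ r) _) (proj₁ (w r)))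

  within⇒≽κ : ∀ {ν} → Within lo hi (row ν) → ν ≽ κ
  within⇒≽κ w = mk≽
    (λ r → ≤-trans (m≤m⊔n (row κ r) _) (proj₁ (w r)))
    (λ r → ≤-trans (proj₂ (w (suc r))) (m⊓n≤n (row α (suc r)) _))

  -- `lo r` pairs with `hi (suc r)`: they are the maximum and the minimum of `row κ r` and
  -- `row α (suc r)`. The pairing is shifted by one, so `hi N` is added on the left and `α` has one
  -- more row on the right.
  ∑-lo+hi : ∀ N → ∑< N (λ r → lo r + hi r) + hi N ≡ ∑< (suc N) (row α) + ∑< N (row κ)
  ∑-lo+hi zero    = sym (+-identityʳ (row α 0))
  ∑-lo+hi (suc N) = begin
    (s + (lo N + hi N)) + hi (suc N)     ≡⟨ +-inner s (lo N) (hi N) (hi (suc N)) ⟩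
    (s + hi N) + (lo N + hi (suc N))     ≡⟨ cong₂ _+_ (∑-lo+hi N) lo+hi ⟩
    (a + k) + (κN + α′)                  ≡⟨ +-swap a k κN α′ ⟩
    (a + α′) + (k + κN)                  ∎
    where
    open ≡-Reasoning
    s  = ∑< N (λ r → lo r + hi r)
    a  = ∑< (suc N) (row α)
    k  = ∑< N (row κ)
    κN = row κ N
    α′ = row α (suc N)
    lo+hi : lo N + hi (suc N) ≡ κN + α′
    lo+hi = trans (cong (lo N +_) (⊓-comm α′ κN)) (⊔+⊓ κN α′)

  module _ {ν : Partition} (α≽ν : α ≽ ν) (ν≽κ : ν ≽ κ) where

    private
      w = ≽⇒within α≽ν ν≽κ

    α≽bk : α ≽ bk ν
    α≽bk = within⇒α≽ (toggle-within w)

    bk≽κ : bk ν ≽ κ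
    bk≽κ = within⇒≽κ (toggle-within w)

    bk-involutive : bk (bk ν) ≡ ν
    bk-involutive = row-injective λ r →
      trans (row-toggle (toggle-within w) r) (reflect-row-toggle w r)

    -- A row and its reflection add up to the two ends of the interval; beyond the rows of `α` the
    -- unpaired `hi N` vanishes.
    ∑-bk : ∀ {N} → row α N ≡ 0 →
           ∑< N (row (bk ν)) + ∑< N (row ν) ≡ ∑< N (row α) + ∑< N (row κ)
    ∑-bk {N} αN≡0 = begin
      ∑< N (row (bk ν)) + ∑< N (row ν)           ≡⟨ ∑-distrib N ⟩
      ∑< N (λ r → lo r + hi r)                   ≡⟨ +-identityʳ _ ⟨
      ∑< N (λ r → lo r + hi r) + 0               ≡⟨ cong (∑< N (λ r → lo r + hi r) +_) (hi-zero αN≡0) ⟨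
      ∑< N (λ r → lo r + hi r) + hi N            ≡⟨ ∑-lo+hi N ⟩
      (∑< N (row α) + row α N) + ∑< N (row κ)    ≡⟨ cong (λ x → (∑< N (row α) + x) + ∑< N (row κ)) αN≡0 ⟩
      (∑< N (row α) + 0) + ∑< N (row κ)          ≡⟨ cong (_+ ∑< N (row κ)) (+-identityʳ _) ⟩
      ∑< N (row α) + ∑< N (row κ)                ∎
      where
      open ≡-Reasoning
      ∑-distrib : ∀ N → ∑< N (row (bk ν)) + ∑< N (row ν) ≡ ∑< N (λ r → lo r + hi r)
      ∑-distrib zero    = refl
      ∑-distrib (suc N) = trans
        (interchange (∑< N (row (bk ν))) (row (bk ν) N) (∑< N (row ν)) (row ν N))
        (cong₂ _+_ (∑-distrib N) (row-toggle-+ {f = row ν} w N))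

-- The local rule (ν₁ , μ , ν₂) ↔ (κ , m)

module LocalRule (ν₁ ν₂ : Partition) where

  lo hi : ℕ → ℕ
  lo r = row ν₁ (suc r) ⊔ row ν₂ (suc r)
  hi r = row ν₁ r ⊓ row ν₂ r

  -- The least length that `ν₁` and `ν₂` allow for row 0 of `μ`. There is no greatest one, so this
  -- row cannot be reflected and `excess` records it instead.
  top : ℕ
  top = row ν₁ 0 ⊔ row ν₂ 0

  hi-chain : ∀ r → hi (suc r) ≤ lo r
  hi-chain r = m⊓n≤m⊔n (row ν₁ (suc r)) (row ν₂ (suc r))

  hi-zero : ∀ {N} → row ν₁ N ≡ 0 → hi N ≡ 0
  hi-zero {N} ν₁N≡0 = ≤-zero (m⊓n≤m (row ν₁ N) _) ν₁N≡0

  open Toggle lo hi (length (parts ν₁)) hi-chain (hi-zero (nth-beyond (parts ν₁) ≤-refl))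

  excess : Partition → ℕ
  excess μ = row μ 0 ∸ top

  down : Partition → Partition
  down μ = toggle lo hi (length (parts ν₁)) (row μ ∘ suc)

  upRows : ℕ → Partition → ℕ → ℕ
  upRows m κ zero    = top + m
  upRows m κ (suc r) = reflect (lo r) (hi r) (row κ r)

  -- Interlacing with `ν₁` permits one row more than `ν₁` has, hence the `suc`.
  up : ℕ → Partition → Partition
  up m κ = fromRows (upRows m κ) (suc (length (parts ν₁)))

  module Down {μ : Partition} (μ≽ν₁ : μ ≽ ν₁) (μ≽ν₂ : μ ≽ ν₂) where

    within : Within lo hi (row μ ∘ suc)
    within r = ⊔-lub (contained μ≽ν₁ (suc r)) (contained μ≽ν₂ (suc r)) ,
               ⊓-glb (interlaced μ≽ν₁ r) (interlaced μ≽ν₂ r)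

    top≤μ : top ≤ row μ 0
    top≤μ = ⊔-lub (contained μ≽ν₁ 0) (contained μ≽ν₂ 0)

    down-within : Within lo hi (row (down μ))
    down-within = toggle-within within

    ν₁≽down : ν₁ ≽ down μ
    ν₁≽down = mk≽
      (λ r → ≤-trans (proj₂ (down-within r)) (m⊓n≤m (row ν₁ r) _))
      (λ r → ≤-trans (m≤m⊔n (row ν₁ (suc r)) _) (proj₁ (down-within r)))

    ν₂≽down : ν₂ ≽ down μ
    ν₂≽down = mk≽
      (λ r → ≤-trans (proj₂ (down-within r)) (m⊓n≤n (row ν₁ r) _))
      (λ r → ≤-trans (m≤n⊔m (row ν₁ (suc r)) _) (proj₁ (down-within r)))

    -- Induction with `hi N` as the unpaired term: `top` pairs with `hi 0`, and `lo N` with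
    -- `hi (suc N)`, as maximum and minimum of the same rows of `ν₁` and `ν₂`. One row more of `μ`
    -- is summed because `down` shifts rows.
    ∑-down′ : ∀ N → (∑< N (row (down μ)) + ∑< (suc N) (row μ)) + hi N ≡
              excess μ + (∑< (suc N) (row ν₁) + ∑< (suc N) (row ν₂))
    ∑-down′ zero = begin
      row μ 0 + hi 0                  ≡⟨ cong (_+ hi 0) (m∸n+n≡m top≤μ) ⟨
      (excess μ + top) + hi 0         ≡⟨ +-assoc (excess μ) top (hi 0) ⟩
      excess μ + (top + hi 0)         ≡⟨ cong (excess μ +_) (⊔+⊓ (row ν₁ 0) (row ν₂ 0)) ⟩
      excess μ + (row ν₁ 0 + row ν₂ 0) ∎
      where open ≡-Reasoning
    ∑-down′ (suc N) = begin
      ((k + κN) + (m + μ′)) + hi (suc N)           ≡⟨ cong (_+ hi (suc N)) (interchange k κN m μ′) ⟩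
      ((k + m) + (κN + μ′)) + hi (suc N)           ≡⟨ cong (λ x → ((k + m) + x) + hi (suc N)) (row-toggle-+ within N) ⟩
      ((k + m) + (lo N + hi N)) + hi (suc N)       ≡⟨ +-inner (k + m) (lo N) (hi N) (hi (suc N)) ⟩
      ((k + m) + hi N) + (lo N + hi (suc N))       ≡⟨ cong₂ _+_ (∑-down′ N) (⊔+⊓ (row ν₁ (suc N)) (row ν₂ (suc N))) ⟩
      (excess μ + (a + b)) + (row ν₁ (suc N) + row ν₂ (suc N))
        ≡⟨ +-assoc (excess μ) (a + b) _ ⟩
      excess μ + ((a + b) + (row ν₁ (suc N) + row ν₂ (suc N)))
        ≡⟨ cong (excess μ +_) (interchange a b (row ν₁ (suc N)) (row ν₂ (suc N))) ⟩
      excess μ + ((a + row ν₁ (suc N)) + (b + row ν₂ (suc N))) ∎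
      where
      open ≡-Reasoning
      k  = ∑< N (row (down μ))
      κN = row (down μ) N
      m  = ∑< (suc N) (row μ)
      μ′ = row μ (suc N)
      a  = ∑< (suc N) (row ν₁)
      b  = ∑< (suc N) (row ν₂)

    up-down : up (excess μ) (down μ) ≡ μ
    up-down = row-injective λ r → trans
      (row-fromRows _ (suc (length (parts ν₁)))
        (λ r → subst₂ _≤_ (sym (agree (suc r))) (sym (agree r)) (row-decreasing μ r))
        (trans (agree (suc (length (parts ν₁))))
          (≤-zero (interlaced μ≽ν₁ _) (nth-beyond (parts ν₁) ≤-refl)))
        r)
      (agree r)
      where
      agree : ∀ r → upRows (excess μ) (down μ) r ≡ row μ r
      agree zero    = m+[n∸m]≡n top≤μ
      agree (suc r) = reflect-row-toggle within r

    ∑-down : ∀ {N} → row μ N ≡ 0 →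
             ∑< N (row (down μ)) + ∑< N (row μ) ≡ excess μ + (∑< N (row ν₁) + ∑< N (row ν₂))
    ∑-down {N} μN≡0 = begin
      k + m                                        ≡⟨ cong (k +_) (+-identityʳ m) ⟨
      k + (m + 0)                                  ≡⟨ +-identityʳ _ ⟨
      (k + (m + 0)) + 0                            ≡⟨ cong₂ (λ x y → (k + (m + x)) + y) μN≡0 (hi-zero ν₁N≡0) ⟨
      (k + ∑< (suc N) (row μ)) + hi N              ≡⟨ ∑-down′ N ⟩
      excess μ + ((a + row ν₁ N) + (b + row ν₂ N)) ≡⟨ cong₂ (λ x y → excess μ + ((a + x) + (b + y))) ν₁N≡0 ν₂N≡0 ⟩
      excess μ + ((a + 0) + (b + 0))               ≡⟨ cong₂ (λ x y → excess μ + (x + y)) (+-identityʳ a) (+-identityʳ b) ⟩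
      excess μ + (a + b)                           ∎
      where
      open ≡-Reasoning
      k = ∑< N (row (down μ))
      m = ∑< N (row μ)
      a = ∑< N (row ν₁)
      b = ∑< N (row ν₂)
      ν₁N≡0 : row ν₁ N ≡ 0
      ν₁N≡0 = ≤-zero (contained μ≽ν₁ N) μN≡0
      ν₂N≡0 : row ν₂ N ≡ 0
      ν₂N≡0 = ≤-zero (contained μ≽ν₂ N) μN≡0

  module Up (m : ℕ) {κ : Partition} (ν₁≽κ : ν₁ ≽ κ) (ν₂≽κ : ν₂ ≽ κ) where

    within : Within lo hi (row κ)
    within r = ⊔-lub (interlaced ν₁≽κ r) (interlaced ν₂≽κ r) , ⊓-glb (contained ν₁≽κ r) (contained ν₂≽κ r)

    row-up : ∀ r → row (up m κ) r ≡ upRows m κ r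
    row-up = row-fromRows (upRows m κ) (suc L) decreasing
      (≤-zero (proj₂ (reflect-within within L)) (hi-zero (nth-beyond (parts ν₁) ≤-refl)))
      where
      L = length (parts ν₁)
      decreasing : Decreasing (upRows m κ)
      decreasing zero    = ≤-trans (proj₂ (reflect-within within 0))
        (≤-trans (m⊓n≤m⊔n (row ν₁ 0) _) (m≤m+n top m))
      decreasing (suc r) = ≤-trans (proj₂ (reflect-within within (suc r)))
        (≤-trans (hi-chain r) (proj₁ (reflect-within within r)))

    up-within : Within lo hi (row (up m κ) ∘ suc)
    up-within = within-resp (sym ∘ row-up ∘ suc) (reflect-within within)

    top≤up : top ≤ row (up m κ) 0
    top≤up = subst (top ≤_) (sym (row-up 0)) (m≤m+n top m)

    up≽ν₁ : up m κ ≽ ν₁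
    up≽ν₁ = mk≽ upper λ r → ≤-trans (proj₂ (up-within r)) (m⊓n≤m (row ν₁ r) _)
      where
      upper : ∀ r → row ν₁ r ≤ row (up m κ) r
      upper zero    = ≤-trans (m≤m⊔n (row ν₁ 0) _) top≤up
      upper (suc r) = ≤-trans (m≤m⊔n (row ν₁ (suc r)) _) (proj₁ (up-within r))

    up≽ν₂ : up m κ ≽ ν₂
    up≽ν₂ = mk≽ upper λ r → ≤-trans (proj₂ (up-within r)) (m⊓n≤n (row ν₁ r) _)
      where
      upper : ∀ r → row ν₂ r ≤ row (up m κ) r
      upper zero    = ≤-trans (m≤n⊔m (row ν₁ 0) _) top≤up
      upper (suc r) = ≤-trans (m≤n⊔m (row ν₁ (suc r)) _) (proj₁ (up-within r))

    excess-up : excess (up m κ) ≡ m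
    excess-up = trans (cong (_∸ top) (row-up 0)) (m+n∸m≡n top m)

    -- With `up-down` and `excess-up`, the local rule for fixed `ν₁` and `ν₂` is a bijection between
    -- the partitions μ and the pairs (κ , m).
    down-up : down (up m κ) ≡ κ
    down-up = row-injective λ r → trans (row-toggle up-within r)
      (trans (cong (reflect (lo r) (hi r)) (row-up (suc r)))
        (reflect-involutive (proj₁ (within r)) (proj₂ (within r))))

-- Exchanging the weights of two consecutive steps

private
  variable
    k n     : ℕ
    α β μ ρ : Partition

-- (ν₁ , μ , ν₂) stands for the part α ⊇ ν₁ ⊆ μ ⊇ ν₂ ⊆ β of a tableau.
Middle : Set
Middle = Partition × Partition × Partition

left centre right : Middle → Partition
left   = proj₁
centre = proj₁ ∘ proj₂
right  = proj₂ ∘ proj₂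

Admissible : Partition → Partition → Middle → Set
Admissible α β (ν₁ , μ , ν₂) = (α ≽ ν₁ × μ ≽ ν₁) × (μ ≽ ν₂ × β ≽ ν₂)

recompute-middle : ∀ {s t : Middle} → .(s ≡ t) → s ≡ t
recompute-middle eq = cong₂ _,_ (recompute-≡ (cong left eq))
  (cong₂ _,_ (recompute-≡ (cong centre eq)) (recompute-≡ (cong right eq)))

open BenderKnuth using (bk; bk-involutive; α≽bk; bk≽κ; ∑-bk)
open LocalRule using (up; down; excess; module Up; module Down)

-- `κ` and `m` are separate arguments, so that the values read off from a swapped middle can be
-- replaced by the original ones.
toggleBoth : Partition → Partition → Partition → ℕ → Partition → Partition → Middle
toggleBoth α β κ m ν₁ ν₂ =
  bk α κ ν₁ , up (bk α κ ν₁) (bk β κ ν₂) m κ , bk β κ ν₂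

opaque
  swap : Partition → Partition → Middle → Middle
  swap α β (ν₁ , μ , ν₂) = toggleBoth α β (down ν₁ ν₂ μ) (excess ν₁ ν₂ μ) ν₁ ν₂

  -- A toggle below `∅` is built with a bound of no rows, so it computes to `∅`. This keeps S′¹ = ∅
  -- when steps 1 and 2 are exchanged.
  left-swap-∅ : ∀ β t → left (swap ∅ β t) ≡ ∅
  left-swap-∅ β t = refl

-- Sizes of skew shapes and the two weights

deg : Partition → Partition → ℕ
deg ρ μ = length (skewBoxes ρ μ)

leftWeight rightWeight : Partition → Partition → Middle → ℕ
leftWeight  α β (ν₁ , μ , ν₂) = deg α ν₁ + deg μ ν₁
rightWeight α β (ν₁ , μ , ν₂) = deg μ ν₂ + deg β ν₂

boxesAbove : Partition → ℕ → List Box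
boxesAbove ρ N = concatMap (λ r → map (r ,_) (upTo (row ρ r))) (upTo N)

module _ (μ : Partition) where

  outside? : ∀ b → Dec (¬ (b ∈ μ))
  outside? b = ¬? (b ∈? μ)

  outside : List Box → ℕ
  outside bs = length (filter outside? bs)

  outside-++ : ∀ bs cs → outside (bs ++ cs) ≡ outside bs + outside cs
  outside-++ bs cs = trans (cong length (filter-++ outside? bs cs)) (length-++ (filter outside? bs))

  outside-row : ∀ r n → outside (map (r ,_) (upTo n)) ≡ n ∸ row μ r
  outside-row r zero    = sym (0∸n≡0 (row μ r))
  outside-row r (suc n) = begin
    outside (map (r ,_) (upTo (suc n)))             ≡⟨ cong (outside ∘ map (r ,_)) (upTo-∷ʳ n) ⟨
    outside (map (r ,_) (upTo n ∷ʳ n))              ≡⟨ cong outside (map-++ (r ,_) (upTo n) _) ⟩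
    outside (map (r ,_) (upTo n) ++ (r , n) ∷ [])   ≡⟨ outside-++ (map (r ,_) (upTo n)) _ ⟩
    outside (map (r ,_) (upTo n)) + outside ((r , n) ∷ []) ≡⟨ cong (_+ outside ((r , n) ∷ [])) (outside-row r n) ⟩
    (n ∸ row μ r) + outside ((r , n) ∷ [])          ≡⟨ last ⟩
    suc n ∸ row μ r                                 ∎
    where
    open ≡-Reasoning
    last : (n ∸ row μ r) + outside ((r , n) ∷ []) ≡ suc n ∸ row μ r
    -- The new box (r , n) counts only if it lies outside `μ`. If it lies inside, both truncated
    -- differences are 0.
    last with n <? row μ r
    ... | yes n<μ = trans (cong (n ∸ row μ r +_) (cong length (filter-reject outside? (contradiction n<μ))))
      (trans (+-identityʳ _) (trans (m≤n⇒m∸n≡0 (<⇒≤ n<μ)) (sym (m≤n⇒m∸n≡0 n<μ))))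
    ... | no  n≮μ = trans (cong (n ∸ row μ r +_) (cong length (filter-accept outside? n≮μ)))
      (trans (+-comm (n ∸ row μ r) 1) (sym (+-∸-assoc 1 (≮⇒≥ n≮μ))))

  outside-boxesAbove : ∀ {ρ} → ρ ≽ μ → ∀ N →
                       outside (boxesAbove ρ N) + ∑< N (row μ) ≡ ∑< N (row ρ)
  outside-boxesAbove         ρ≽μ zero    = refl
  outside-boxesAbove {ρ = ρ} ρ≽μ (suc N) = begin
    outside (boxesAbove ρ (suc N)) + (∑< N (row μ) + row μ N)  ≡⟨ cong (_+ (∑< N (row μ) + row μ N)) peel ⟩
    (outside (boxesAbove ρ N) + (row ρ N ∸ row μ N)) + (∑< N (row μ) + row μ N)
      ≡⟨ interchange (outside (boxesAbove ρ N)) (row ρ N ∸ row μ N) (∑< N (row μ)) (row μ N) ⟩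
    (outside (boxesAbove ρ N) + ∑< N (row μ)) + ((row ρ N ∸ row μ N) + row μ N)
      ≡⟨ cong₂ _+_ (outside-boxesAbove ρ≽μ N) (m∸n+n≡m (contained ρ≽μ N)) ⟩
    ∑< N (row ρ) + row ρ N ∎
    where
    open ≡-Reasoning
    F : ℕ → List Box
    F r = map (r ,_) (upTo (row ρ r))
    peel : outside (boxesAbove ρ (suc N)) ≡ outside (boxesAbove ρ N) + (row ρ N ∸ row μ N)
    peel = begin
      outside (concatMap F (upTo (suc N)))                   ≡⟨ cong (outside ∘ concatMap F) (upTo-∷ʳ N) ⟨
      outside (concatMap F (upTo N ∷ʳ N))                    ≡⟨ cong outside (concatMap-++ F (upTo N) _) ⟩
      outside (boxesAbove ρ N ++ F N ++ [])                  ≡⟨ outside-++ (boxesAbove ρ N) _ ⟩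
      outside (boxesAbove ρ N) + outside (F N ++ [])         ≡⟨ cong (λ bs → outside (boxesAbove ρ N) + outside bs) (++-identityʳ (F N)) ⟩
      outside (boxesAbove ρ N) + outside (F N)               ≡⟨ cong (outside (boxesAbove ρ N) +_) (outside-row N (row ρ N)) ⟩
      outside (boxesAbove ρ N) + (row ρ N ∸ row μ N)         ∎

∑<-+-zeros : ∀ {f L} → (∀ {r} → L ≤ r → f r ≡ 0) → ∀ d → ∑< (d + L) f ≡ ∑< L f
∑<-+-zeros             zeros zero    = refl
∑<-+-zeros {f} {L} zeros (suc d) =
  trans (cong₂ _+_ (∑<-+-zeros zeros d) (zeros (m≤n+m L d))) (+-identityʳ _)

∑<-stable : ∀ {f L N} → (∀ {r} → L ≤ r → f r ≡ 0) → L ≤ N → ∑< N f ≡ ∑< L f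
∑<-stable {f} {L} {N} zeros L≤N =
  subst (λ M → ∑< M f ≡ ∑< L f) (m∸n+n≡m L≤N) (∑<-+-zeros zeros (N ∸ L))

-- Turns counts of boxes into differences of row sums, with a bound `N` that several shapes can
-- share.
deg-+ : ∀ {N} → ρ ≽ μ → length (parts ρ) ≤ N → deg ρ μ + ∑< N (row μ) ≡ ∑< N (row ρ)
deg-+ {ρ} {μ} {N} ρ≽μ L≤N = begin
  deg ρ μ + ∑< N (row μ)   ≡⟨ cong (deg ρ μ +_) (∑<-stable μ-zeros L≤N) ⟩
  deg ρ μ + ∑< L (row μ)   ≡⟨ outside-boxesAbove μ ρ≽μ L ⟩
  ∑< L (row ρ)             ≡⟨ ∑<-stable (nth-beyond (parts ρ)) L≤N ⟨
  ∑< N (row ρ)             ∎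
  where
  open ≡-Reasoning
  L = length (parts ρ)
  μ-zeros : ∀ {r} → L ≤ r → row μ r ≡ 0
  μ-zeros {r} L≤r = ≤-zero (contained ρ≽μ r) (nth-beyond (parts ρ) L≤r)

-- Sizes: w₁, w₂, M′ are the values of v₁, v₂, M after the swap.
weights-cancel : ∀ {A M M′ B K m v₁ v₂ w₁ w₂ x₁ x₂ y₁ y₂ : ℕ} →
  x₁ + w₁ ≡ A → x₂ + w₁ ≡ M′ → y₁ + v₂ ≡ M → y₂ + v₂ ≡ B →
  K + M ≡ m + (v₁ + v₂) → K + M′ ≡ m + (w₁ + w₂) →
  w₁ + v₁ ≡ A + K → w₂ + v₂ ≡ B + K →
  x₁ + x₂ ≡ y₁ + y₂
weights-cancel {K = K} {m} {v₁} {v₂} {w₁} {w₂} {x₁} {x₂} {y₁} {y₂} refl refl refl refl localM localM′ bk₁ bk₂ =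
  begin
    x₁ + x₂         ≡⟨ cong (x₁ +_) x₂≡ ⟩
    x₁ + (m + y₂)   ≡⟨ +-assoc x₁ m y₂ ⟨
    (x₁ + m) + y₂   ≡⟨ cong (_+ y₂) (trans (+-comm x₁ m) (sym y₁≡)) ⟩
    y₁ + y₂         ∎
  where
  open ≡-Reasoning
  -- By the Bender-Knuth identities α ∖ ν₁′ has the size of ν₁ ∖ κ and, in `w₂≡`, β ∖ ν₂ that of ν₂′
  -- ∖ κ.
  v₁≡ : v₁ ≡ x₁ + K
  v₁≡ = +-cancelˡ-≡ w₁ _ _ (trans bk₁ (trans (cong (_+ K) (+-comm x₁ w₁)) (+-assoc w₁ x₁ K)))
  w₂≡ : w₂ ≡ y₂ + K
  w₂≡ = +-cancelˡ-≡ v₂ _ _ (trans (+-comm v₂ w₂) (trans bk₂ (trans (cong (_+ K) (+-comm y₂ v₂)) (+-assoc v₂ y₂ K))))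
  -- By the local rule for μ, the strip μ ∖ ν₂ exceeds ν₁ ∖ κ, hence α ∖ ν₁′, by `m` boxes; `x₂≡` is
  -- the mirror statement for μ′.
  y₁≡ : y₁ ≡ m + x₁
  y₁≡ = +-cancelʳ-≡ K _ _ (+-cancelʳ-≡ v₂ _ _ (begin
    (y₁ + K) + v₂         ≡⟨ cong (_+ v₂) (+-comm y₁ K) ⟩
    (K + y₁) + v₂         ≡⟨ +-assoc K y₁ v₂ ⟩
    K + (y₁ + v₂)         ≡⟨ localM ⟩
    m + (v₁ + v₂)         ≡⟨ +-assoc m v₁ v₂ ⟨
    (m + v₁) + v₂         ≡⟨ cong (λ v → (m + v) + v₂) v₁≡ ⟩
    (m + (x₁ + K)) + v₂   ≡⟨ cong (_+ v₂) (+-assoc m x₁ K) ⟨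
    ((m + x₁) + K) + v₂   ∎))
  x₂≡ : x₂ ≡ m + y₂
  x₂≡ = +-cancelʳ-≡ K _ _ (+-cancelʳ-≡ w₁ _ _ (begin
    (x₂ + K) + w₁         ≡⟨ cong (_+ w₁) (+-comm x₂ K) ⟩
    (K + x₂) + w₁         ≡⟨ +-assoc K x₂ w₁ ⟩
    K + (x₂ + w₁)         ≡⟨ localM′ ⟩
    m + (w₁ + w₂)         ≡⟨ cong (m +_) (+-comm w₁ w₂) ⟩
    m + (w₂ + w₁)         ≡⟨ +-assoc m w₂ w₁ ⟨
    (m + w₂) + w₁         ≡⟨ cong (λ w → (m + w) + w₁) w₂≡ ⟩
    (m + (y₂ + K)) + w₁   ≡⟨ cong (_+ w₁) (+-assoc m y₂ K) ⟨
    ((m + y₂) + K) + w₁   ∎))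

deg-cancel : ∀ {α β μ μ′ κ ν₁ ν₂ ν₁′ ν₂′ m} →
  α ≽ ν₁′ → μ′ ≽ ν₁′ → μ ≽ ν₂ → β ≽ ν₂ →
  (∀ {N} → row μ N ≡ 0 →
    ∑< N (row κ) + ∑< N (row μ) ≡ m + (∑< N (row ν₁) + ∑< N (row ν₂))) →
  (∀ {N} → row μ′ N ≡ 0 →
    ∑< N (row κ) + ∑< N (row μ′) ≡ m + (∑< N (row ν₁′) + ∑< N (row ν₂′))) →
  (∀ {N} → row α N ≡ 0 →
    ∑< N (row ν₁′) + ∑< N (row ν₁) ≡ ∑< N (row α) + ∑< N (row κ)) →
  (∀ {N} → row β N ≡ 0 →
    ∑< N (row ν₂′) + ∑< N (row ν₂) ≡ ∑< N (row β) + ∑< N (row κ)) →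
  deg α ν₁′ + deg μ′ ν₁′ ≡ deg μ ν₂ + deg β ν₂
deg-cancel {α} {β} {μ} {μ′} {κ} {ν₁} {ν₂} {m = m} α≽ν₁′ μ′≽ν₁′ μ≽ν₂ β≽ν₂ local local′ bk₁ bk₂ =
  weights-cancel {K = ∑< N (row κ)} {m} {∑< N (row ν₁)} {∑< N (row ν₂)}
    (deg-+ α≽ν₁′ α≤N) (deg-+ μ′≽ν₁′ μ′≤N) (deg-+ μ≽ν₂ μ≤N) (deg-+ β≽ν₂ β≤N)
    (local (nth-beyond (parts μ) μ≤N)) (local′ (nth-beyond (parts μ′) μ′≤N))
    (bk₁ (nth-beyond (parts α) α≤N)) (bk₂ (nth-beyond (parts β) β≤N))
  where
  a = length (parts α)
  b = length (parts β)
  c = length (parts μ)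
  d = length (parts μ′)
  -- Past the last rows of all four shapes, so every row-sum identity applies at this one `N`.
  N = (a + b) + (c + d)
  α≤N : a ≤ N
  α≤N = ≤-trans (m≤m+n a b) (m≤m+n (a + b) (c + d))
  β≤N : b ≤ N
  β≤N = ≤-trans (m≤n+m b a) (m≤m+n (a + b) (c + d))
  μ≤N : c ≤ N
  μ≤N = ≤-trans (m≤m+n c d) (m≤n+m (c + d) (a + b))
  μ′≤N : d ≤ N
  μ′≤N = ≤-trans (m≤n+m d c) (m≤n+m (c + d) (a + b))

-- Properties of the swap

module Swap {α β : Partition} {t : Middle} (adm : Admissible α β t) where

  private
    ν₁ = left t
    μ₀ = centre t
    ν₂ = right t
    κ  = down ν₁ ν₂ μ₀
    m  = excess ν₁ ν₂ μ₀
    α≽ν₁ = proj₁ (proj₁ adm)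
    μ≽ν₁ = proj₂ (proj₁ adm)
    μ≽ν₂ = proj₁ (proj₂ adm)
    β≽ν₂ = proj₂ (proj₂ adm)
    module D = Down ν₁ ν₂ μ≽ν₁ μ≽ν₂
    ν₁′ = bk α κ ν₁
    ν₂′ = bk β κ ν₂
    module U = Up ν₁′ ν₂′ m (bk≽κ α κ α≽ν₁ D.ν₁≽down) (bk≽κ β κ β≽ν₂ D.ν₂≽down)
    μ′  = up ν₁′ ν₂′ m κ

  opaque
    unfolding swap

    swap-admissible : Admissible α β (swap α β t)
    swap-admissible = (α≽bk α κ α≽ν₁ D.ν₁≽down , U.up≽ν₁) , (U.up≽ν₂ , α≽bk β κ β≽ν₂ D.ν₂≽down)

    -- The new middle yields the same `κ` and `m`; the toggles relative to this `κ` then undo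
    -- themselves, and `up` over the old `ν₁` and `ν₂` rebuilds `μ₀`.
    swap-involutive : swap α β (swap α β t) ≡ t
    swap-involutive = begin
      toggleBoth α β (down ν₁′ ν₂′ μ′) (excess ν₁′ ν₂′ μ′) ν₁′ ν₂′
        ≡⟨ cong₂ (λ κ m → toggleBoth α β κ m ν₁′ ν₂′) U.down-up U.excess-up ⟩
      toggleBoth α β κ m ν₁′ ν₂′
        ≡⟨ cong₂ (λ a b → a , up a b m κ , b)
             (bk-involutive α κ α≽ν₁ D.ν₁≽down) (bk-involutive β κ β≽ν₂ D.ν₂≽down) ⟩
      (ν₁ , up ν₁ ν₂ m κ , ν₂)
        ≡⟨ cong (λ μ → ν₁ , μ , ν₂) D.up-down ⟩
      t ∎
      where open ≡-Reasoning

    leftWeight-swap : leftWeight α β (swap α β t) ≡ rightWeight α β t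
    leftWeight-swap = deg-cancel {α} {β} {μ₀} {μ′} {κ} {ν₁} {ν₂} {ν₁′} {ν₂′} {m}
      (proj₁ (proj₁ swap-admissible)) U.up≽ν₁ μ≽ν₂ β≽ν₂
      (λ {N} → D.∑-down {N}) local′
      (λ {N} → ∑-bk α κ α≽ν₁ D.ν₁≽down {N}) (λ {N} → ∑-bk β κ β≽ν₂ D.ν₂≽down {N})
      where
      local′ : ∀ {N} → row μ′ N ≡ 0 → ∑< N (row κ) + ∑< N (row μ′) ≡ m + (∑< N (row ν₁′) + ∑< N (row ν₂′))
      -- The local identity for the swapped middle speaks of its own `down` and `excess`; transport
      -- brings it to the same `κ` and `m`, which can then cancel.
      local′ {N} = subst₂
        (λ κ m → row μ′ N ≡ 0 → ∑< N (row κ) + ∑< N (row μ′) ≡ m + (∑< N (row ν₁′) + ∑< N (row ν₂′)))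
        U.down-up U.excess-up (Down.∑-down ν₁′ ν₂′ {μ′} U.up≽ν₁ U.up≽ν₂ {N})

open Swap

-- This is `leftWeight-swap` at the swapped middle, since the swap is an involution.
rightWeight-swap : ∀ {t} → Admissible α β t → rightWeight α β (swap α β t) ≡ leftWeight α β t
rightWeight-swap {α} {β} adm = trans (sym (leftWeight-swap (swap-admissible adm)))
  (cong (leftWeight α β) (swap-involutive adm))

-- Tableaux

strips⇒admissible : ∀ {ν₁ ν₂} → HorizontalStrip α ν₁ → HorizontalStrip μ ν₁ →
                    HorizontalStrip μ ν₂ → HorizontalStrip β ν₂ → Admissible α β (ν₁ , μ , ν₂)
strips⇒admissible a b c d = (strip⇒≽ a , strip⇒≽ b) , (strip⇒≽ c , strip⇒≽ d)

module _ {t : Middle} (adm : Admissible α β t) where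

  strip₁ : HorizontalStrip α (left t)
  strip₁ = ≽⇒strip (proj₁ (proj₁ adm))

  strip₂ : HorizontalStrip (centre t) (left t)
  strip₂ = ≽⇒strip (proj₂ (proj₁ adm))

  strip₃ : HorizontalStrip (centre t) (right t)
  strip₃ = ≽⇒strip (proj₁ (proj₂ adm))

  strip₄ : HorizontalStrip β (right t)
  strip₄ = ≽⇒strip (proj₂ (proj₂ adm))

∅-strip : HorizontalStrip ∅ ∅
∅-strip = ≽⇒strip {∅} {∅} (mk≽ (λ _ → ≤-refl) (λ _ → ≤-refl))

-- Step 1 is read as a deletion of ∅ ∖ ∅ followed by an addition. The left component is `∅` only up
-- to a proof, as it is in the output of `swap`.
extendFirst : (t : Middle) → .(left t ≡ ∅) → .(Admissible ∅ β t) → Tableau 2 β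
extendFirst {β} (ν₁ , μ , ν₂) ν₁≡∅ adm =
  step (first μ (subst (HorizontalStrip μ) ν₁≡∅ (strip₂ adm))) ν₂ β (strip₃ adm) (strip₄ adm)

extend : Tableau k α → (t : Middle) → .(Admissible α β t) → Tableau (suc (suc k)) β
extend {β = β} S (ν₁ , μ , ν₂) adm =
  step (step S ν₁ μ (strip₁ adm) (strip₂ adm)) ν₂ β (strip₃ adm) (strip₄ adm)

extendFirst-cong : ∀ {t t′} → t ≡ t′ → .(p : left t ≡ ∅) .(p′ : left t′ ≡ ∅)
                   .(q : Admissible ∅ β t) .(q′ : Admissible ∅ β t′) →
                   extendFirst t p q ≡ extendFirst t′ p′ q′
extendFirst-cong refl p p′ q q′ = refl

extend-cong : ∀ {S : Tableau k α} {t t′} → t ≡ t′ →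
              .(q : Admissible α β t) .(q′ : Admissible α β t′) → extend S t q ≡ extend S t′ q′
extend-cong refl q q′ = refl

swapLast : Tableau k μ → (ν ρ : Partition) → .(HorizontalStrip μ ν) → .(HorizontalStrip ρ ν) →
           Tableau (suc k) ρ
swapLast (first μ a) ν ρ d e =
  extendFirst (swap ∅ ρ (∅ , μ , ν)) (left-swap-∅ ρ _) (swap-admissible (strips⇒admissible ∅-strip a d e))
swapLast (step {μ = α} S ν₁ μ a b) ν ρ d e =
  extend S (swap α ρ (ν₁ , μ , ν)) (swap-admissible (strips⇒admissible a b d e))

-- d counts from the end: swapAt d acts on the steps k − 1 − d and k − d.
swapAt : ℕ → Tableau k ρ → Tableau k ρ
swapAt d       (first ρ a)      = first ρ a
swapAt zero    (step S ν ρ d e) = swapLast S ν ρ d e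
swapAt (suc d) (step S ν ρ a b) = step (swapAt d S) ν ρ a b

-- `swapAt` reads the middle back with a literal `∅` on the left, so the second swap acts on `t′`
-- and not on `swap ∅ ρ t`; `left-swap-∅` identifies the two.
swap-extendFirst : ∀ μ ν .(adm : Admissible ∅ ρ (∅ , μ , ν)) →
  swapAt 0 (extendFirst (swap ∅ ρ (∅ , μ , ν)) (left-swap-∅ ρ _) (swap-admissible adm)) ≡
  extendFirst (∅ , μ , ν) refl adm
swap-extendFirst {ρ} μ ν adm =
  extendFirst-cong t″≡t (left-swap-∅ ρ t′) refl
    (swap-admissible (subst (λ ν₁ → Admissible ∅ ρ (ν₁ , centre t′ , right t′)) (left-swap-∅ ρ t)
      (swap-admissible adm)))
    adm
  where
  t t′ : Middle
  t  = ∅ , μ , ν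
  t′ = ∅ , centre (swap ∅ ρ t) , right (swap ∅ ρ t)
  t″≡t : swap ∅ ρ t′ ≡ t
  t″≡t = trans
    (cong (λ ν₁ → swap ∅ ρ (ν₁ , centre t′ , right t′)) (sym (left-swap-∅ ρ t)))
    (recompute-middle (swap-involutive adm))

swapAt-involutive : ∀ d (S : Tableau k ρ) → swapAt d (swapAt d S) ≡ S
swapAt-involutive d    (first ρ a) = refl
swapAt-involutive zero (step (first μ a) ν ρ d e) =
  swap-extendFirst μ ν (strips⇒admissible ∅-strip a d e)
swapAt-involutive zero (step (step {μ = α} S ν₁ μ a b) ν ρ d e) =
  extend-cong (recompute-middle (swap-involutive (strips⇒admissible a b d e)))
    (swap-admissible (swap-admissible (strips⇒admissible a b d e))) (strips⇒admissible a b d e)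
swapAt-involutive (suc d) (step S ν ρ a b) = cong (λ T → step T ν ρ a b) (swapAt-involutive d S)

-- Weights and sizes of tableaux

weight : ℕ → Tableau k ρ → ℕ
weight j S = length (filter (λ e → proj₂ e ≟ j) (letters S))

count : (j l n : ℕ) → ℕ
count j l n with l ≟ j
... | yes _ = n
... | no  _ = 0

count-≡ : ∀ j n → count j j n ≡ n
count-≡ j n with j ≟ j
... | yes _  = refl
... | no j≢j = contradiction refl j≢j

count-≢ : ∀ {j l} n → l ≢ j → count j l n ≡ 0
count-≢ {j} {l} n l≢j with l ≟ j
... | yes l≡j = contradiction l≡j l≢j
... | no  _   = refl

filter-letter : ∀ j l (bs : List Box) →
                length (filter (λ e → proj₂ e ≟ j) (map (_, l) bs)) ≡ count j l (length bs)
filter-letter j l bs with l ≟ j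
... | yes refl = trans (cong length (filter-all (λ e → proj₂ e ≟ j) (map⁺ (universal (λ _ → refl) bs))))
                       (length-map (_, l) bs)
... | no l≢j   = cong length (filter-none (λ e → proj₂ e ≟ j) (map⁺ (universal (λ _ → l≢j) bs)))

module _ {k} {μ} (S : Tableau k μ) (ν ρ : Partition)
         .(d : HorizontalStrip μ ν) .(e : HorizontalStrip ρ ν) where

  weight-step : ∀ j → weight j (step S ν ρ d e) ≡ weight j S + count j (suc k) (deg μ ν + deg ρ ν)
  weight-step j = begin
    length (filter P? (letters S ++ map (_, suc k) bs))                  ≡⟨ cong length (filter-++ P? (letters S) _) ⟩
    length (filter P? (letters S) ++ filter P? (map (_, suc k) bs))      ≡⟨ length-++ (filter P? (letters S)) ⟩
    weight j S + length (filter P? (map (_, suc k) bs))                  ≡⟨ cong (weight j S +_) (filter-letter j (suc k) bs) ⟩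
    weight j S + count j (suc k) (length bs)                             ≡⟨ cong (λ n → weight j S + count j (suc k) n) (length-++ (skewBoxes μ ν)) ⟩
    weight j S + count j (suc k) (deg μ ν + deg ρ ν)                     ∎
    where
    open ≡-Reasoning
    bs = skewBoxes μ ν ++ skewBoxes ρ ν
    P? = λ (e : Box × ℕ) → proj₂ e ≟ j

  size-step : size (step S ν ρ d e) ≡ size S + (deg μ ν + deg ρ ν)
  size-step = trans (length-++ (letters S))
    (cong (size S +_) (trans (length-map _ (skewBoxes μ ν ++ _)) (length-++ (skewBoxes μ ν))))

-- Gives `base-zero`: the steps before an exchanged pair contribute neither of its two letters.
weight-beyond : ∀ {j} (S : Tableau k ρ) → k < j → weight j S ≡ 0
weight-beyond {j = j} (first ρ _) 1<j =
  trans (filter-letter j 1 (skewBoxes ρ ∅)) (count-≢ _ (<⇒≢ 1<j))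
weight-beyond {j = j} (step {μ = μ} S ν ρ d e) k<j = trans (weight-step S ν ρ d e j)
  (cong₂ _+_ (weight-beyond S (<-trans (n<1+n _) k<j)) (count-≢ (deg μ ν + deg ρ ν) (<⇒≢ k<j)))

-- x and y are the numbers of letters k and k + 1 in T, base and base-size the
-- weights and the size of the first k − 1 steps, common to T and T′.
record Exchanged {k ρ} (T T′ : Tableau (suc k) ρ) : Set where
  field
    base      : ℕ → ℕ
    base-size : ℕ
    x y       : ℕ
    base-zero : ∀ {j} → k ≤ j → base j ≡ 0
    weight-T  : ∀ j → weight j T  ≡ (base j + count j k x) + count j (suc k) y
    weight-T′ : ∀ j → weight j T′ ≡ (base j + count j k y) + count j (suc k) x
    size-T    : size T  ≡ (base-size + x) + y
    size-T′   : size T′ ≡ (base-size + y) + x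

extendFirst-exchanged : ∀ μ ν .(adm : Admissible ∅ ρ (∅ , μ , ν)) →
  Exchanged (extendFirst (∅ , μ , ν) refl adm)
            (extendFirst (swap ∅ ρ (∅ , μ , ν)) (left-swap-∅ ρ _) (swap-admissible adm))
extendFirst-exchanged {ρ} μ ν adm = record
  { base      = λ _ → 0
  ; base-size = 0
  ; x         = leftWeight ∅ ρ t
  ; y         = rightWeight ∅ ρ t
  ; base-zero = λ _ → refl
  ; weight-T  = λ j → weights j (∅ , μ , ν) refl adm
  ; weight-T′ = λ j → trans (weights j (swap ∅ ρ t) (left-swap-∅ ρ t) (swap-admissible adm))
                        (cong₂ (λ x y → count j 1 x + count j 2 y) left-eq right-eq)
  ; size-T    = sizes (∅ , μ , ν) refl adm
  ; size-T′   = trans (sizes (swap ∅ ρ t) (left-swap-∅ ρ t) (swap-admissible adm))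
                  (cong₂ _+_ left-eq right-eq)
  }
  where
  t : Middle
  t = ∅ , μ , ν
  left-eq : leftWeight ∅ ρ (swap ∅ ρ t) ≡ rightWeight ∅ ρ t
  left-eq = recompute (_ ≟ _) (leftWeight-swap adm)
  right-eq : rightWeight ∅ ρ (swap ∅ ρ t) ≡ leftWeight ∅ ρ t
  right-eq = recompute (_ ≟ _) (rightWeight-swap adm)
  weights : ∀ j t (eq : left t ≡ ∅) .(adm : Admissible ∅ ρ t) → weight j (extendFirst t eq adm) ≡
            count j 1 (leftWeight ∅ ρ t) + count j 2 (rightWeight ∅ ρ t)
  -- Once the left component is `∅`, `deg ∅ ∅` computes to 0 and the left weight is that of
  -- `first μ`.
  weights j (.∅ , μ , ν) refl adm = trans (weight-step (first μ (strip₂ adm)) ν ρ (strip₃ adm) (strip₄ adm) j)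
    (cong (_+ count j 2 (deg μ ν + deg ρ ν)) (filter-letter j 1 (skewBoxes μ ∅)))
  sizes : ∀ t (eq : left t ≡ ∅) .(adm : Admissible ∅ ρ t) → size (extendFirst t eq adm) ≡
          leftWeight ∅ ρ t + rightWeight ∅ ρ t
  sizes (.∅ , μ , ν) refl adm = trans (size-step (first μ (strip₂ adm)) ν ρ (strip₃ adm) (strip₄ adm))
    (cong (_+ (deg μ ν + deg ρ ν)) (length-map _ (skewBoxes μ ∅)))

extend-exchanged : ∀ (S : Tableau k α) t .(adm : Admissible α ρ t) →
  Exchanged (extend S t adm) (extend S (swap α ρ t) (swap-admissible adm))
extend-exchanged {k} {α} {ρ} S t adm = record
  { base      = λ j → weight j S
  ; base-size = size S
  ; x         = leftWeight α ρ t
  ; y         = rightWeight α ρ t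
  ; base-zero = weight-beyond S
  ; weight-T  = λ j → weights j t adm
  ; weight-T′ = λ j → trans (weights j (swap α ρ t) (swap-admissible adm))
                        (cong₂ (λ x y → (weight j S + count j (suc k) x) + count j (suc (suc k)) y) left-eq right-eq)
  ; size-T    = sizes t adm
  ; size-T′   = trans (sizes (swap α ρ t) (swap-admissible adm))
                  (cong₂ (λ x y → (size S + x) + y) left-eq right-eq)
  }
  where
  left-eq : leftWeight α ρ (swap α ρ t) ≡ rightWeight α ρ t
  left-eq = recompute (_ ≟ _) (leftWeight-swap adm)
  right-eq : rightWeight α ρ (swap α ρ t) ≡ leftWeight α ρ t
  right-eq = recompute (_ ≟ _) (rightWeight-swap adm)
  weights : ∀ j t .(adm : Admissible α ρ t) → weight j (extend S t adm) ≡
            (weight j S + count j (suc k) (leftWeight α ρ t)) + count j (suc (suc k)) (rightWeight α ρ t)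
  weights j (ν₁ , μ , ν) adm = trans (weight-step (step S ν₁ μ (strip₁ adm) (strip₂ adm)) ν ρ (strip₃ adm) (strip₄ adm) j)
    (cong (_+ count j (suc (suc k)) (deg μ ν + deg ρ ν)) (weight-step S ν₁ μ (strip₁ adm) (strip₂ adm) j))
  sizes : ∀ t .(adm : Admissible α ρ t) → size (extend S t adm) ≡
          (size S + leftWeight α ρ t) + rightWeight α ρ t
  sizes (ν₁ , μ , ν) adm = trans (size-step (step S ν₁ μ (strip₁ adm) (strip₂ adm)) ν ρ (strip₃ adm) (strip₄ adm))
    (cong (_+ (deg μ ν + deg ρ ν)) (size-step S ν₁ μ (strip₁ adm) (strip₂ adm)))

swapLast-exchanged : (S : Tableau k μ) (ν ρ : Partition)
                     .(d : HorizontalStrip μ ν) .(e : HorizontalStrip ρ ν) →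
                     Exchanged (step S ν ρ d e) (swapLast S ν ρ d e)
swapLast-exchanged (first μ a) ν ρ d e =
  extendFirst-exchanged μ ν (strips⇒admissible ∅-strip a d e)
swapLast-exchanged (step S ν₁ μ a b) ν ρ d e =
  extend-exchanged S (ν₁ , μ , ν) (strips⇒admissible a b d e)

module _ {k ρ} {T T′ : Tableau (suc k) ρ} (ex : Exchanged T T′) where
  open Exchanged ex

  private
    count-k : ∀ x y → (base k + count k k x) + count k (suc k) y ≡ x
    count-k x y rewrite base-zero {k} ≤-refl | count-≡ k x | count-≢ y (1+n≢n {k}) = +-identityʳ x

    count-suc-k : ∀ x y → (base (suc k) + count (suc k) k x) + count (suc k) (suc k) y ≡ y
    count-suc-k x y rewrite base-zero (n≤1+n k) | count-≢ x (<⇒≢ (n<1+n k)) | count-≡ (suc k) y = refl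

    count-other : ∀ {j} → j ≢ k → j ≢ suc k → ∀ x y →
                  (base j + count j k x) + count j (suc k) y ≡ base j
    count-other {j} j≢k j≢1+k x y
      rewrite count-≢ x (≢-sym j≢k) | count-≢ y (≢-sym j≢1+k) = trans (+-identityʳ _) (+-identityʳ _)

  exchanged-weight : weight k T′ ≡ weight (suc k) T
  exchanged-weight = trans (trans (weight-T′ k) (count-k y x))
    (sym (trans (weight-T (suc k)) (count-suc-k x y)))

  exchanged-weight-other : ∀ {j} → j ≢ k → j ≢ suc k → weight j T′ ≡ weight j T
  exchanged-weight-other {j} j≢k j≢1+k = trans (trans (weight-T′ j) (count-other j≢k j≢1+k y x))
    (sym (trans (weight-T j) (count-other j≢k j≢1+k x y)))

  exchanged-size : size T′ ≡ size T
  exchanged-size = trans size-T′ (trans (+-assoc base-size y x)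
    (trans (cong (base-size +_) (+-comm y x)) (trans (sym (+-assoc base-size x y)) (sym size-T))))

-- Effect of the exchange on whole tableaux

size-swapAt : ∀ d (S : Tableau k ρ) → size (swapAt d S) ≡ size S
size-swapAt d       (first ρ _)      = refl
size-swapAt zero    (step S ν ρ d e) = exchanged-size (swapLast-exchanged S ν ρ d e)
size-swapAt (suc d) (step {μ = μ} S ν ρ a b) = trans (size-step (swapAt d S) ν ρ a b)
  (trans (cong (_+ (deg μ ν + deg ρ ν)) (size-swapAt d S)) (sym (size-step S ν ρ a b)))

-- The equation `k ≡ suc (d + i)` says that `swapAt d` acts on the steps i and i + 1. The `d` later
-- steps carry letters beyond i + 1 and contribute to neither weight.
weight-swapAt : ∀ d {i} (S : Tableau k ρ) → k ≡ suc (d + i) → 1 ≤ i →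
                 weight i (swapAt d S) ≡ weight (suc i) S
weight-swapAt d {i} (first ρ _) eq 1≤i =
  -- A single step would force d + i = 0, so the default clause of `swapAt` is not reached.
  contradiction (≤-trans 1≤i (m≤n+m i d)) (λ 1≤d+i → <⇒≢ 1≤d+i (suc-injective eq))
weight-swapAt zero (step S ν ρ d e) refl 1≤i = exchanged-weight (swapLast-exchanged S ν ρ d e)
weight-swapAt (suc d) {i} (step {μ = μ} S ν ρ a b) refl 1≤i = begin
  weight i (step (swapAt d S) ν ρ a b)      ≡⟨ weight-step (swapAt d S) ν ρ a b i ⟩
  weight i (swapAt d S) + count i _ c       ≡⟨ cong₂ _+_ (weight-swapAt d S refl 1≤i) (trans (count-≢ c i≢) (sym (count-≢ c 1+i≢))) ⟩
  weight (suc i) S + count (suc i) _ c      ≡⟨ weight-step S ν ρ a b (suc i) ⟨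
  weight (suc i) (step S ν ρ a b)           ∎
  where
  open ≡-Reasoning
  c = deg μ ν + deg ρ ν
  1+i≢ : suc (suc (d + i)) ≢ suc i
  1+i≢ = ≢-sym (<⇒≢ (s≤s (s≤s (m≤n+m i d))))
  i≢ : suc (suc (d + i)) ≢ i
  i≢ = ≢-sym (<⇒≢ (s≤s (≤-trans (m≤n+m i d) (n≤1+n _))))

weight-swapAt-other : ∀ d {i j} (S : Tableau k ρ) → k ≡ suc (d + i) → j ≢ i → j ≢ suc i →
                      weight j (swapAt d S) ≡ weight j S
weight-swapAt-other d    (first ρ _) eq j≢i j≢1+i = refl
weight-swapAt-other zero (step S ν ρ d e) refl j≢i j≢1+i =
  exchanged-weight-other (swapLast-exchanged S ν ρ d e) j≢i j≢1+i
weight-swapAt-other (suc d) {j = j} (step {μ = μ} S ν ρ a b) refl j≢i j≢1+i =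
  trans (weight-step (swapAt d S) ν ρ a b j)
    (trans (cong (_+ count j _ (deg μ ν + deg ρ ν)) (weight-swapAt-other d S refl j≢i j≢1+i))
      (sym (weight-step S ν ρ a b j)))

SSOT-≡ : {S T : SSOT k n ρ} → proj₁ S ≡ proj₁ T → S ≡ T
SSOT-≡ {S = S , p} {T = .S , q} refl = cong (S ,_) (≡-irrelevant p q)

lemma4p26 : (k n : ℕ) → k ≥ 1 → (ρ : Partition) →
    (i : ℕ) → 1 ≤ i → i ≤ k ∸ 1 →
    Σ (SSOT k n ρ → SSOT k n ρ) (λ g →
    Involutive _≡_ g ×
    ((S : SSOT k n ρ) →
    ((wt i (g S) , wt (suc i) (g S)) ≡ (wt (suc i) S , wt i S)) ×
    ((j : ℕ) → j ≢ i → j ≢ suc i → wt j (g S) ≡ wt j S)))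
lemma4p26 (suc k) n k≥1 ρ i 1≤i i≤k =
  (λ (S , |S|≡n) → swapAt d S , trans (size-swapAt d S) |S|≡n) ,
  (λ (S , _) → SSOT-≡ (swapAt-involutive d S)) ,
  λ (S , _) →
    cong₂ _,_ (weight-swapAt d S k≡ 1≤i)
      -- The second weight is the first statement at `swapAt d S`, read through involutivity.
      (trans (sym (weight-swapAt d (swapAt d S) k≡ 1≤i)) (cong (weight i) (swapAt-involutive d S))) ,
    λ j → weight-swapAt-other d S k≡
  where
  -- Among `suc k` steps, `swapAt d` acts on the steps k - d and k - d + 1, which are to be i and i
  -- + 1.
  d = k ∸ i
  k≡ : suc k ≡ suc (d + i)
  k≡ = cong suc (sym (m∸n+n≡m i≤k))
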